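{- Let $n$ be a positive integer with factorization type $F(n)=(a_1,a_2,\ldots,a_d)$. Let $X$ be a maximal clique in the divisibility relation graph $D_n$. Then $$|X| = 1+\sum_{i=1}^d a_i = 1+\Omega(n).$$
   Context: For a positive integer $n$, the divisibility relation graph $D_n$ is the simple undirected graph whose vertex set is the set of all positive divisors of $n$, in which two vertices $a\neq b$ are adjacent if and only if $a\mid b$ or $b\mid a$. Writing $n=p_1^{a_1}\cdots p_d^{a_d}$ with $p_1,\dots,p_d$ distinct primes and $1\leq a_1\leq a_2\leq\cdots\leq a_d$, the factorization type of $n$ is $F(n)=(a_1,\ldots,a_d)$, and the degree of $n$ is $\Omega(n)=\sum_{i=1}^d a_i$, the number of prime factors of $n$ counted with multiplicity. -}

module Defs where

open import Data.Fin.Base as Fin using (Fin)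
open import Data.List.Base using (List; length)
import Data.List.Membership.Propositional as List
open import Data.List.Relation.Unary.Unique.Propositional using (Unique)
open import Data.Nat.Base using (ℕ; _≤_; _^_; NonZero)
open import Data.Nat.Divisibility using (_∣_)
open import Data.Nat.Primality using (Prime)
open import Data.Nat.Primality.Factorisation using (factors; factorise)
open import Data.Nat.Properties using (+-0-monoid; *-1-monoid)
open import Data.Product.Base using (_×_; _,_)
open import Data.Refinement.Base using (Refinement; value)
open import Data.Sum.Base using (_⊎_; swap)
open import Data.Vec.Functional using (Vector)
open import Function.Base using (_∘_)
open import Function.Definitions using (Injective)
open import Relation.Binary.Core using (Rel)
open import Relation.Binary.Definitions using (Symmetric; Irreflexive)
open import Relation.Binary.PropositionalEquality.Core
  using (_≡_; _≢_; refl; sym; cong)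

open import Algebra.Properties.Monoid.Sum +-0-monoid public using (sum)
open import Algebra.Properties.Monoid.Sum *-1-monoid public
  renaming (sum to product) using ()

-- A finite set is given by a duplicate-free list of its elements; the order
-- of the list plays no role below, since sets are only compared through _⊆_.
record FiniteSet (A : Set) : Set where
  field
    elements : List A
    unique   : Unique elements

open FiniteSet public

module _ {A : Set} where

  infix 4 _∈_ _⊆_

  _∈_ : A → FiniteSet A → Set
  x ∈ X = x List.∈ elements X

  _⊆_ : FiniteSet A → FiniteSet A → Set
  X ⊆ Y = ∀ {x} → x ∈ X → x ∈ Y

  card : FiniteSet A → ℕ
  card X = length (elements X)

record SimpleGraph : Set₁ where
  field
    Vertex     : Set
    Adj        : Rel Vertex _
    adj-sym    : Symmetric Adj
    adj-irrefl : Irreflexive _≡_ Adj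

module _ (G : SimpleGraph) where
  open SimpleGraph G

  IsClique : FiniteSet Vertex → Set
  IsClique X = ∀ {u v} → u ∈ X → v ∈ X → u ≢ v → Adj u v

  -- Maximal with respect to inclusion, not a clique of largest cardinality.
  IsMaximalClique : FiniteSet Vertex → Set
  IsMaximalClique X = IsClique X × (∀ Y → IsClique Y → X ⊆ Y → Y ⊆ X)

-- The divisibility proof stored in a divisor is irrelevant, so two divisors
-- are equal as soon as their values are.
Divisor : ℕ → Set
Divisor n = Refinement ℕ (_∣ n)

D : ℕ → SimpleGraph
D n = record
  { Vertex     = Divisor n
  ; Adj        = λ a b → a ≢ b × (value a ∣ value b ⊎ value b ∣ value a)
  ; adj-sym    = λ (a≢b , c) → (a≢b ∘ sym) , swap c
  ; adj-irrefl = λ a≡b (a≢b , _) → a≢b a≡b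
  }

-- FactorizationType n a says F(n) = (a₁, …, a_d).
record FactorizationType (n : ℕ) {d : ℕ} (a : Vector ℕ d) : Set where
  field
    p          : Vector ℕ d
    p-prime    : ∀ i → Prime (p i)
    p-distinct : Injective _≡_ _≡_ p
    a-positive : ∀ i → 1 ≤ a i
    a-sorted   : ∀ {i j} → i Fin.≤ j → a i ≤ a j
    n≡∏p^a     : n ≡ product (λ i → p i ^ a i)

-- The number of prime factors of n, counted with multiplicity.
Ω : (n : ℕ) .{{_ : NonZero n}} → ℕ
Ω n = length (factors (factorise n))

{-# OPTIONS --safe #-}
-- In the clique X any two distinct elements are comparable under divisibility,
-- so Ω is injective on X, with values in {0, …, Ω n}.  Every value is attained:
-- 1 ∈ X, and if x ∈ X with Ω x < Ω n, let u be the least element of X above x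
-- (or n if there is none) and p a prime dividing u / x.  Then x * p is
-- comparable with every element of X, hence lies in X by maximality, and has
-- one more prime factor than x.
module Submission where

open import Defs
open import Data.Nat.Base using (ℕ; _+_; NonZero)
open import Data.Product.Base using (_×_)
open import Data.Vec.Functional using (Vector)
open import Relation.Binary.PropositionalEquality.Core using (_≡_)

open import Data.Empty using (⊥-elim-irr)
open import Data.Fin.Base using (zero; suc)
open import Data.Irrelevant using ([_])
open import Data.List.Base using (List; []; _∷_; _++_; length; map; filter; upTo)
open import Data.List.Extrema using (argmin; argmin-all; f[argmin]≤f[xs])
import Data.List.Membership.DecPropositional as DecMembership
import Data.List.Membership.Propositional as List
open import Data.List.Membership.Propositional.Properties
  using (∈-map⁺; ∈-map⁻; ∈-filter⁺; ∈-filter⁻; ∈-upTo⁺; ∈-upTo⁻)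
open import Data.List.Membership.Propositional.Properties.WithK using (unique∧set⇒bag)
open import Data.List.Properties using (length-++; length-map; length-upTo)
open import Data.List.Relation.Binary.BagAndSetEquality using (∼bag⇒↭)
open import Data.List.Relation.Binary.Permutation.Propositional.Properties using (↭-length)
open import Data.List.Relation.Unary.All as All using ([]; _∷_)
import Data.List.Relation.Unary.All.Properties as All
open import Data.List.Relation.Unary.AllPairs using ([]; _∷_)
open import Data.List.Relation.Unary.Any using (here; there)
open import Data.List.Relation.Unary.Unique.Propositional using (Unique)
open import Data.List.Relation.Unary.Unique.Propositional.Properties using (upTo⁺)
open import Data.Nat.Base
  using (zero; suc; _*_; _^_; _≤_; _<_; s≤s; s≤s⁻¹; ≢-nonZero⁻¹)
open import Data.Nat.Divisibility
import Data.Nat.ListAction as List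
open import Data.Nat.ListAction.Properties using (product-++)
open import Data.Nat.Primality using (Prime; prime⇒nonZero)
open import Data.Nat.Primality.Factorisation
open import Data.Nat.Properties
open import Data.Product.Base using (_,_; ∃-syntax; proj₁; proj₂)
open import Data.Refinement.Base using (_,_; value)
import Data.Refinement.Properties as Refinement
open import Data.Sum.Base using (_⊎_; inj₁; inj₂; swap)
open import Function.Base using (_∘_)
open import Function.Bundles using (mk⇔)
open import Relation.Binary.Definitions using (DecidableEquality)
open import Relation.Binary.PropositionalEquality
  using (_≢_; refl; sym; trans; cong; cong₂; subst; module ≡-Reasoning)
open import Relation.Nullary.Decidable using (yes; no; recompute)
open import Relation.Nullary.Negation using (contradiction)

open PrimeFactorisation using (isFactorisation; factorsPrime)

-- Additivity and monotonicity of `Ω`.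

_*ᶠ_ : ∀ {m n} → PrimeFactorisation m → PrimeFactorisation n → PrimeFactorisation (m * n)
f *ᶠ g = record
  { factors         = factors f ++ factors g
  ; isFactorisation = trans (cong₂ _*_ (isFactorisation f) (isFactorisation g))
                            (sym (product-++ (factors f) (factors g)))
  ; factorsPrime    = All.++⁺ (factorsPrime f) (factorsPrime g)
  }

-- Any two prime factorisations of `n` agree up to permutation, so `Ω n` can be read off whichever
-- one is convenient.
Ω-unique : ∀ {n} .{{_ : NonZero n}} (f : PrimeFactorisation n) → Ω n ≡ length (factors f)
Ω-unique {n} f = ↭-length (factorisationUnique (factorise n) f)

Ω-prime : ∀ {p} .{{_ : NonZero p}} → Prime p → Ω p ≡ 1
Ω-prime pr = Ω-unique (primeFactorisation[p] pr)

Ω-* : ∀ m n .{{_ : NonZero m}} .{{_ : NonZero n}} .{{_ : NonZero (m * n)}} →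
      Ω (m * n) ≡ Ω m + Ω n
Ω-* m n = trans (Ω-unique (factorise m *ᶠ factorise n)) (length-++ (factors (factorise m)))

Ω-^ : ∀ {p} → Prime p → ∀ a .{{_ : NonZero (p ^ a)}} → Ω (p ^ a) ≡ a
Ω-^     pr zero    = refl
Ω-^ {p} pr (suc a) = trans (Ω-* p (p ^ a)) (cong₂ _+_ (Ω-prime pr) (Ω-^ pr a))
  where instance
    _ = prime⇒nonZero pr
    _ = m^n≢0 p a

Ω-∏^ : ∀ {d} (p a : Vector ℕ d) → (∀ i → Prime (p i)) →
       .{{_ : NonZero (product (λ i → p i ^ a i))}} →
       Ω (product (λ i → p i ^ a i)) ≡ sum a
Ω-∏^ {zero}  p a pr = refl
Ω-∏^ {suc d} p a pr {{nz}} =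
  trans (Ω-* p₀^a₀ rest) (cong₂ _+_ (Ω-^ (pr zero) (a zero)) (Ω-∏^ (p ∘ suc) (a ∘ suc) (pr ∘ suc)))
  where
  p₀^a₀ = p zero ^ a zero
  rest  = product (λ i → p (suc i) ^ a (suc i))
  instance
    _ : NonZero p₀^a₀
    _ = m*n≢0⇒m≢0 p₀^a₀ {{nz}}
    _ : NonZero rest
    _ = m*n≢0⇒n≢0 p₀^a₀ {{nz}}

Ω-mono-∣ : ∀ {m n} .{{_ : NonZero m}} .{{_ : NonZero n}} → m ∣ n → Ω m ≤ Ω n
Ω-mono-∣ {m} {{_}} {{n≢0}} (divides-refl q) =
  subst (Ω m ≤_) (sym (Ω-* q m)) (m≤n+m (Ω m) (Ω q))
  where instance
    _ : NonZero q
    _ = m*n≢0⇒m≢0 q {{n≢0}}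

Ω-*-prime : ∀ m {p} → Prime p → .{{_ : NonZero m}} .{{_ : NonZero (m * p)}} →
            Ω (m * p) ≡ suc (Ω m)
Ω-*-prime m {p} pr = begin
  Ω (m * p)  ≡⟨ Ω-* m p ⟩
  Ω m + Ω p  ≡⟨ cong (Ω m +_) (Ω-prime pr) ⟩
  Ω m + 1    ≡⟨ +-comm (Ω m) 1 ⟩
  suc (Ω m)  ∎
  where
  open ≡-Reasoning
  instance _ = prime⇒nonZero pr

-- The quotient `q` is not 1, since otherwise `m` would equal `n`; the head of its list of prime
-- factors serves as `p`.
∣∧≢⇒*-prime-∣ : ∀ {m n} .{{_ : NonZero n}} → m ∣ n → m ≢ n →
                ∃[ p ] Prime p × m * p ∣ n
∣∧≢⇒*-prime-∣ {m} {{n≢0}} (divides-refl q) m≢qm = go (factorise q)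
  where
  instance
    _ : NonZero q
    _ = m*n≢0⇒m≢0 q {{n≢0}}
  go : PrimeFactorisation q → ∃[ p ] Prime p × m * p ∣ q * m
  go record { factors = [] ; isFactorisation = refl } =
    contradiction (sym (*-identityˡ m)) m≢qm
  go record { factors = p ∷ ps ; isFactorisation = refl ; factorsPrime = pr ∷ _ } =
    p , pr , subst (_∣ q * m) (*-comm p m) (*-monoˡ-∣ m (m∣m*n {p} (List.product ps)))

-- Some `m * p` with `p` prime still divides `n`, and it already has one prime factor more than `m`.
Ω-mono-< : ∀ {m n} .{{_ : NonZero m}} .{{_ : NonZero n}} → m ∣ n → m ≢ n → Ω m < Ω n
Ω-mono-< {m} {n} m∣n m≢n with p , pr , mp∣n ← ∣∧≢⇒*-prime-∣ m∣n m≢n =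
  subst (_≤ Ω n) (Ω-*-prime m pr) (Ω-mono-∣ mp∣n)
  where instance
    _ = prime⇒nonZero pr
    _ = m*n≢0 m p

-- In the second case `n ∣ m` forces `n ≤ m`, hence equality. This turns comparisons of size inside
-- a clique into divisibility.
comparable∧≤⇒∣ : ∀ {m n} .{{_ : NonZero m}} → m ∣ n ⊎ n ∣ m → m ≤ n → m ∣ n
comparable∧≤⇒∣ (inj₁ m∣n) m≤n = m∣n
comparable∧≤⇒∣ (inj₂ n∣m) m≤n = ∣-reflexive (≤-antisym m≤n (∣⇒≤ n∣m))

-- Counting with duplicate-free lists.

module _ {A B : Set} (f : A → B) where

  -- Injectivity is asked only on the entries of `xs`, because `rank` is injective on a clique but
  -- in general not on all divisors.
  Unique-map⁺-local : ∀ {xs} → (∀ {x y} → x List.∈ xs → y List.∈ xs → f x ≡ f y → x ≡ y) →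
                      Unique xs → Unique (map f xs)
  Unique-map⁺-local inj []           = []
  Unique-map⁺-local inj (x∉xs ∷ xs!) =
    All.map⁺ (All.tabulate λ y∈xs → All.lookup x∉xs y∈xs ∘ inj (here refl) (there y∈xs))
      ∷ Unique-map⁺-local (λ x∈ y∈ → inj (there x∈) (there y∈)) xs!

-- Each element occurs at most once, so mutual inclusion is already equality as bags, which gives a
-- permutation.
unique∧set⇒length≡ : {A : Set} {xs ys : List A} → Unique xs → Unique ys →
                     (∀ {x} → x List.∈ xs → x List.∈ ys) →
                     (∀ {x} → x List.∈ ys → x List.∈ xs) →
                     length xs ≡ length ys
unique∧set⇒length≡ xs! ys! xs⊆ys ys⊆xs =
  ↭-length (∼bag⇒↭ (unique∧set⇒bag xs! ys! (mk⇔ xs⊆ys ys⊆xs)))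

-- Maximal cliques in an arbitrary graph.

module _ (G : SimpleGraph) (_≟ᵛ_ : DecidableEquality (SimpleGraph.Vertex G)) where
  open SimpleGraph G
  open DecMembership _≟ᵛ_ using (_∈?_)

  -- Adjoining `v` to `X` gives a larger clique, which maximality puts back inside `X`. Membership
  -- is decided first because the enlarged list has to stay duplicate-free.
  maximalClique-absorbs : ∀ {X v} → IsMaximalClique G X →
                          (∀ {u} → u ∈ X → u ≢ v → Adj u v) → v ∈ X
  maximalClique-absorbs {X} {v} (clique , maximal) adj with v ∈? elements X
  ... | yes v∈X = v∈X
  ... | no  v∉X = maximal X∪v clique′ there (here refl)
    where
    X∪v : FiniteSet Vertex
    X∪v = record { elements = v ∷ elements X ; unique = All.¬Any⇒All¬ _ v∉X ∷ unique X }

    clique′ : IsClique G X∪v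
    clique′ (here refl) (here refl) u≢w = contradiction refl u≢w
    clique′ (here refl) (there w∈X) u≢w = adj-sym (adj w∈X (u≢w ∘ sym))
    clique′ (there u∈X) (here refl) u≢w = adj u∈X u≢w
    clique′ (there u∈X) (there w∈X) u≢w = clique u∈X w∈X u≢w

-- The stored proof is irrelevant; decidability of divisibility allows a usable one to be
-- recomputed.
value-∣ : ∀ {n} (x : Divisor n) → value x ∣ n
value-∣ {n} (x , [ x∣n ]) = recompute (x ∣? n) x∣n

value-nonZero : ∀ {n} .{{_ : NonZero n}} (x : Divisor n) → NonZero (value x)
value-nonZero {n} (zero  , [ 0∣n ]) = ⊥-elim-irr (≢-nonZero⁻¹ n (0∣⇒≡0 0∣n))
value-nonZero     (suc _ , _)       = _

-- Ranks of the elements of a maximal clique of `D n`.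

module MaximalClique (n : ℕ) .{{_ : NonZero n}} (X : FiniteSet (Divisor n))
                     (X-maximal : IsMaximalClique (D n) X) where

  _≟ᵈ_ : DecidableEquality (Divisor n)
  _≟ᵈ_ = Refinement._≟_ _≟_

  rank : Divisor n → ℕ
  rank x = Ω (value x) {{value-nonZero x}}

  comparable : ∀ {x y} → x ∈ X → y ∈ X → value x ∣ value y ⊎ value y ∣ value x
  comparable {x} {y} x∈X y∈X with x ≟ᵈ y
  ... | yes refl = inj₁ ∣-refl
  ... | no  x≢y  = proj₂ (proj₁ X-maximal x∈X y∈X x≢y)

  absorbs : ∀ {v} → (∀ {u} → u ∈ X → value u ∣ value v ⊎ value v ∣ value u) → v ∈ X
  absorbs comp =
    maximalClique-absorbs (D n) _≟ᵈ_ {X = X} X-maximal λ u∈X u≢v → u≢v , comp u∈X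

  rank-mono-< : ∀ {x y} → value x ∣ value y → x ≢ y → rank x < rank y
  rank-mono-< {x} {y} x∣y x≢y =
    Ω-mono-< {{value-nonZero x}} {{value-nonZero y}} x∣y (x≢y ∘ Refinement.value-injective)

  -- Distinct elements of a clique are comparable, and proper divisibility strictly raises the rank.
  rank-injective : ∀ {x y} → x ∈ X → y ∈ X → rank x ≡ rank y → x ≡ y
  rank-injective {x} {y} x∈X y∈X eq with x ≟ᵈ y | comparable x∈X y∈X
  ... | yes x≡y | _        = x≡y
  ... | no  x≢y | inj₁ x∣y = contradiction eq (<⇒≢ (rank-mono-< x∣y x≢y))
  ... | no  x≢y | inj₂ y∣x = contradiction (sym eq) (<⇒≢ (rank-mono-< y∣x (x≢y ∘ sym)))

  module _ {x} (x∈X : x ∈ X) (x≢n : value x ≢ n) where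

    above : List (Divisor n)
    above = filter (λ y → value x <? value y) (elements X)

    top : Divisor n
    top = n , [ ∣-refl ]

    -- The default `top` is the value when no element of `X` exceeds `x`.
    next : Divisor n
    next = argmin ≤-totalOrder value top above

    -- What `top` and the entries of `above` have in common, so that it passes to their minimum.
    -- Comparability with `X` replaces membership, as it holds for `top` at once.
    IsUpper : Divisor n → Set
    IsUpper u = value x < value u × (∀ {y} → y ∈ X → value u ∣ value y ⊎ value y ∣ value u)

    next-isUpper : IsUpper next
    next-isUpper = argmin-all ≤-totalOrder value {P = IsUpper}
      (≤∧≢⇒< (∣⇒≤ (value-∣ x)) x≢n , λ {y} _ → inj₂ (value-∣ y))
      (All.tabulate λ u∈above → let u∈X , x<u = ∈-filter⁻ (λ y → value x <? value y) u∈above in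
        x<u , λ y∈X → comparable u∈X y∈X)

    -- No element of `X` lies strictly between `x` and `next` in size, and comparability upgrades
    -- both size bounds to divisibility.
    next-covers : ∀ {y} → y ∈ X → value y ∣ value x ⊎ value next ∣ value y
    next-covers {y} y∈X with value x <? value y
    ... | no  x≮y = inj₁ (comparable∧≤⇒∣ {{value-nonZero y}} (comparable y∈X x∈X) (≮⇒≥ x≮y))
    ... | yes x<y = inj₂ (comparable∧≤⇒∣ {{value-nonZero next}} (proj₂ next-isUpper y∈X)
      (All.lookup (f[argmin]≤f[xs] ≤-totalOrder top above)
        (∈-filter⁺ (λ y → value x <? value y) y∈X x<y)))

    x∣next : value x ∣ value next
    x∣next = comparable∧≤⇒∣ {{value-nonZero x}} (swap (proj₂ next-isUpper x∈X))
      (<⇒≤ (proj₁ next-isUpper))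

    rank-successor : ∃[ y ] y ∈ X × rank y ≡ suc (rank x)
    rank-successor
      with p , pr , xp∣next ← ∣∧≢⇒*-prime-∣ {{value-nonZero next}} x∣next (<⇒≢ (proj₁ next-isUpper)) =
      xp , absorbs comp , Ω-*-prime (value x) pr {{value-nonZero x}} {{value-nonZero xp}}
      where
      xp : Divisor n
      xp = value x * p , [ ∣-trans xp∣next (value-∣ next) ]

      -- `xp` lies between `x` and `next` in divisibility, so it is comparable with whatever is
      -- below the one or above the other.
      comp : ∀ {y} → y ∈ X → value y ∣ value xp ⊎ value xp ∣ value y
      comp y∈X with next-covers y∈X
      ... | inj₁ y∣x    = inj₁ (∣m⇒∣m*n p y∣x)
      ... | inj₂ next∣y = inj₂ (∣-trans xp∣next next∣y)

  rank-surjective : ∀ k → k ≤ Ω n → ∃[ x ] x ∈ X × rank x ≡ k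
  rank-surjective zero    _   = (1 , [ 1∣ n ]) , absorbs (λ {u} _ → inj₂ (1∣ value u)) , refl
  rank-surjective (suc k) k<Ω with rank-surjective k (<⇒≤ k<Ω)
  -- If `value x` were `n`, its rank would be `Ω n`, against `k<Ω`. Splitting `x` makes `value x` a
  -- variable that `refl` can unify with `n`.
  ... | x@(_ , _) , x∈X , refl = rank-successor x∈X λ { refl → <-irrefl refl k<Ω }

  card≡1+Ω : card X ≡ 1 + Ω n
  card≡1+Ω = begin
    length (elements X)             ≡⟨ length-map rank (elements X) ⟨
    length (map rank (elements X))  ≡⟨ unique∧set⇒length≡
                                         (Unique-map⁺-local rank rank-injective (unique X))
                                         (upTo⁺ (1 + Ω n)) to from ⟩
    length (upTo (1 + Ω n))         ≡⟨ length-upTo (1 + Ω n) ⟩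
    1 + Ω n                         ∎
    where
    open ≡-Reasoning
    to : ∀ {k} → k List.∈ map rank (elements X) → k List.∈ upTo (1 + Ω n)
    to k∈ with x , _ , refl ← ∈-map⁻ rank k∈ =
      ∈-upTo⁺ (s≤s (Ω-mono-∣ {{value-nonZero x}} (value-∣ x)))

    from : ∀ {k} → k List.∈ upTo (1 + Ω n) → k List.∈ map rank (elements X)
    from {k} k∈ with x , x∈X , refl ← rank-surjective k (s≤s⁻¹ (∈-upTo⁻ k∈)) = ∈-map⁺ rank x∈X

proposition2p15 : (n : ℕ) .{{_ : NonZero n}} (d : ℕ) (a : Vector ℕ d) →
    FactorizationType n a →
    (X : FiniteSet (Divisor n)) → IsMaximalClique (D n) X →
    (card X ≡ 1 + sum a) × (1 + sum a ≡ 1 + Ω n)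
proposition2p15 n d a type X X-maximal = trans card≡1+Ω (sym 1+sum≡1+Ω) , 1+sum≡1+Ω
  where
  open MaximalClique n X X-maximal using (card≡1+Ω)
  open FactorizationType type

  -- Stated for a fresh `m`: matching `n≡∏p^a` itself against `refl` would be circular, since `p`
  -- comes from `type`, whose type mentions `n`.
  sum≡Ω : ∀ {m} .{{_ : NonZero m}} → m ≡ product (λ i → p i ^ a i) → sum a ≡ Ω m
  sum≡Ω refl = sym (Ω-∏^ p a p-prime)

  1+sum≡1+Ω : 1 + sum a ≡ 1 + Ω n
  1+sum≡1+Ω = cong suc (sum≡Ω n≡∏p^a)
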